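{- Let $T$ be the rooted infinite tree in which the root is at level $0$ and every vertex at level $n$ has exactly $2^n$ children (at level $n+1$). Then the random basic walk on $T$ is transient with positive probability: the probability that it escapes to infinity (visits infinitely many vertices, each finitely often) is strictly greater than $0$.
   Context: Each undirected edge $\{v,w\}$ is regarded as two arcs $v\to w$ and $w\to v$. A labeling assigns, at each vertex $v$ of degree $\deg(v)$, the port numbers $1,\dots,\deg(v)$ bijectively to the arcs leaving $v$ (labels on $v\to w$ and $w\to v$ need not agree). In a random labeling these bijections are chosen uniformly at random, independently for different vertices. Given a labeling, a starting vertex $v_0$ and an initial port $\ell$, the basic walk leaves $v_0$ along the arc labeled $\ell$; thereafter, whenever it enters a vertex $v$ along an arc whose label is $i$, it leaves $v$ along the arc out of $v$ labeled $(i \bmod \deg(v))+1$. The random basic walk is the basic walk for a random labeling. -}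

module Defs where

open import Data.Fin.Base using (Fin; zero; suc; toℕ)
open import Data.Integer.Base using (+_)
open import Data.List.Base using (List; map; foldr; upTo)
open import Data.List.Membership.Propositional using (_∉_)
open import Data.List.Relation.Unary.All using (All)
open import Data.List.Relation.Unary.Unique.Propositional using (Unique)
open import Data.Maybe.Base using (Maybe; maybe′)
open import Data.Nat.Base as ℕ using (ℕ; zero; suc; _^_; _!; NonZero)
open import Data.Nat.DivMod using (_mod_)
open import Data.Nat.Properties using (_!≢0)
open import Data.Product.Base using (Σ; ∃; _×_; _,_; proj₁)
open import Data.Rational.Base using (ℚ; 0ℚ; 1ℚ; _+_; _*_; _/_; _≤_; _<_)
open import Function.Bundles using (_↔_; Inverse; mk↔ₛ′)
open import Level using (0ℓ)
open import Relation.Binary.PropositionalEquality using (_≡_; _≢_; refl)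
open import Relation.Unary using (Pred; _⊆_; _≐_; ∁; ⋃; ∅)

-- Locally finite graphs without isolated vertices.  An edge {v , w} is the
-- pair of an arc v ⟶ w and its reverse.

record Graph : Set₁ where
  infix 4 _⟶_
  field
    Vertex      : Set
    _⟶_         : Vertex → Vertex → Set
    reverse     : ∀ {v w} → v ⟶ w → w ⟶ v
    deg         : Vertex → ℕ
    deg-nonZero : ∀ v → NonZero (deg v)
    deg-counts  : ∀ v → Fin (deg v) ↔ ∃ (v ⟶_)

module _ (G : Graph) where
  open Graph G

  -- The element p of Port v stands for the port number suc (toℕ p), so that
  -- Port v represents 1 , … , deg v.

  Port : Vertex → Set
  Port v = Fin (deg v)

  LocalLabeling : Vertex → Set
  LocalLabeling v = Port v ↔ ∃ (v ⟶_)

  Labeling : Set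
  Labeling = ∀ v → LocalLabeling v

  -- Entering w along an arc with port number i = suc (toℕ p), the walk leaves
  -- through port number (i mod deg w) + 1, which is represented by i mod deg w.

  nextPort : ∀ {v} → Port v → (w : Vertex) → Port w
  nextPort p w = (suc (toℕ p) mod deg w) {{deg-nonZero w}}

  -- A state is the current vertex together with the port through which the
  -- walk is about to leave it.

  State : Set
  State = Σ Vertex Port

  step : Labeling → State → State
  step ω (v , p) = let w = proj₁ (Inverse.to (ω v) p) in w , nextPort p w

  walk : Labeling → State → ℕ → State
  walk ω s zero    = s
  walk ω s (suc n) = step ω (walk ω s n)

  position : Labeling → (v₀ : Vertex) → Port v₀ → ℕ → Vertex
  position ω v₀ ℓ n = proj₁ (walk ω (v₀ , ℓ) n)

  -- Infinitely many vertices are visited: no finite list contains them all.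

  EscapesToInfinity : (v₀ : Vertex) → Port v₀ → Pred Labeling 0ℓ
  EscapesToInfinity v₀ ℓ ω =
    (∀ (vs : List Vertex) → ∃ λ n → position ω v₀ ℓ n ∉ vs) ×
    (∀ v → ∃ λ N → ∀ n → N ℕ.≤ n → position ω v₀ ℓ n ≢ v)

  -- The law of the random labeling is the product over all vertices v of the
  -- uniform distributions on the (deg v)! local labelings at v.  A cylinder
  -- prescribes the local labelings at finitely many distinct vertices, hence
  -- has probability ∏ 1/(deg v)! over these vertices.

  record Cylinder : Set where
    field
      prescribed : List (Σ Vertex LocalLabeling)
      distinct   : Unique (map proj₁ prescribed)

  ⟦_⟧ : Cylinder → Pred Labeling 0ℓ
  ⟦ C ⟧ ω = All (λ (v , π) → ∀ p → Inverse.to (ω v) p ≡ Inverse.to π p)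
                (Cylinder.prescribed C)

  mass : Cylinder → ℚ
  mass C = foldr (λ (v , _) r → (+ 1 / (deg v !)) {{deg v !≢0}} * r) 1ℚ
                 (Cylinder.prescribed C)

  -- The σ-algebra generated by the cylinders.  Predicates are intensional,
  -- hence the closure under extensional equality.

  data Measurable : Pred Labeling 0ℓ → Set₁ where
    cylinder   : ∀ C → Measurable ⟦ C ⟧
    complement : ∀ {A} → Measurable A → Measurable (∁ A)
    union      : ∀ {A : ℕ → Pred Labeling 0ℓ} →
                 (∀ n → Measurable (A n)) → Measurable (⋃ ℕ A)
    resp-≐     : ∀ {A B} → A ≐ B → Measurable A → Measurable B

  -- Countable covers by cylinders; nothing stands for the empty set.

  CylinderSeq : Set
  CylinderSeq = ℕ → Maybe Cylinder

  Covers : CylinderSeq → Pred Labeling 0ℓ → Set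
  Covers C A = A ⊆ ⋃ ℕ (λ k → maybe′ ⟦_⟧ ∅ (C k))

  partialMass : CylinderSeq → ℕ → ℚ
  partialMass C n = foldr (λ k r → maybe′ mass 0ℚ (C k) + r) 0ℚ (upTo n)

  -- The probability of an event is its Carathéodory outer measure
  --   inf { ∑ₖ mass (C k) | C covers A }.
  -- q ≥ℙ A says that the total mass of some cover of A is at most q, so the
  -- infimum is that of the rationals q with q ≥ℙ A, and it is positive iff
  -- these have a positive rational lower bound.

  _≥ℙ_ : ℚ → Pred Labeling 0ℓ → Set
  q ≥ℙ A = ∃ λ C → Covers C A × (∀ n → partialMass C n ≤ q)

  HasPositiveProbability : Pred Labeling 0ℓ → Set₁
  HasPositiveProbability A =
    Measurable A × (∃ λ ε → 0ℚ < ε × (∀ q → q ≥ℙ A → ε ≤ q))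

-- The vertices of the tree: one at level n has 2 ^ n children.

data TVertex : Set
level : TVertex → ℕ

data TVertex where
  root  : TVertex
  child : (v : TVertex) → Fin (2 ^ level v) → TVertex

level root        = 0
level (child v _) = suc (level v)

data TArc : TVertex → TVertex → Set where
  down : ∀ v i → TArc v (child v i)
  up   : ∀ v i → TArc (child v i) v

reverseᵀ : ∀ {v w} → TArc v w → TArc w v
reverseᵀ (down v i) = up v i
reverseᵀ (up v i)   = down v i

degᵀ : TVertex → ℕ
degᵀ root          = 2 ^ level root
degᵀ v@(child _ _) = suc (2 ^ level v)

degᵀ-nonZero : ∀ v → NonZero (degᵀ v)
degᵀ-nonZero root        = _
degᵀ-nonZero (child _ _) = _

degᵀ-counts : ∀ v → Fin (degᵀ v) ↔ ∃ (TArc v)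
degᵀ-counts root = mk↔ₛ′
  (λ i → child root i , down root i)
  (λ { (_ , down _ i) → i })
  (λ { (_ , down _ _) → refl })
  (λ _ → refl)
degᵀ-counts u@(child v i) = mk↔ₛ′
  (λ { zero → v , up v i ; (suc j) → child u j , down u j })
  (λ { (_ , up _ _) → zero ; (_ , down _ j) → suc j })
  (λ { (_ , up _ _) → refl ; (_ , down _ _) → refl })
  (λ { zero → refl ; (suc _) → refl })

T : Graph
T = record
  { Vertex      = TVertex
  ; _⟶_         = TArc
  ; reverse     = reverseᵀ
  ; deg         = degᵀ
  ; deg-nonZero = degᵀ-nonZero
  ; deg-counts  = degᵀ-counts
  }

{-# OPTIONS --safe #-}
module Submission where

-- The walk started at v₀ escapes whenever it only ever moves away from the
-- root.  Entering a new vertex with x children, it leaves through a port that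
-- is independent of the labels there, hence moves down with probability
-- x / (x + 1); the product of these factors over x = 2ⁿ is positive.
--
-- A cover C of too small total mass is refuted by the method of conditional
-- expectations.  Local labelings are revealed level by level.  At the current
-- vertex of the walk only labelings sending the walk down are considered, at
-- all other vertices every labeling is; a labeling is chosen for which the
-- total conditional mass of C is at most its average over the candidates.
-- This mass stays below 1, so the limit labeling lies in no cylinder of C
-- (such a cylinder would have conditional mass 1 once its vertices are
-- revealed), although the walk escapes.

open import Axiom.ExcludedMiddle using (ExcludedMiddle)
open import Data.Bool.Base using (if_then_else_)
open import Data.Empty using (⊥)
open import Data.Fin.Base using (Fin; zero; suc; punchIn)
open import Data.Fin.Permutation using (Permutation′; _⟨$⟩ʳ_; id; insert; remove; insert-punchIn; insert-remove)
open import Data.Fin.Properties as Fin using (punchIn-injective; suc-injective)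
open import Data.Integer.Base as ℤ using (+_)
import Data.Integer.Properties as ℤ
open import Data.List.Base using (List; []; _∷_; map; length; foldr; upTo; applyUpTo; allFin; concatMap; cartesianProductWith)
open import Data.List.Membership.Propositional using (_∈_; _∉_; lose)
open import Data.List.Membership.Propositional.Properties using (∈-allFin; ∈-map⁺; ∈-map⁻; ∈-concatMap⁺; ∈-upTo⁺)
open import Data.List.Properties using (length-map; length-++; length-tabulate)
open import Data.List.Relation.Unary.All as All using (All; []; _∷_)
import Data.List.Relation.Unary.All.Properties as All
open import Data.List.Relation.Unary.AllPairs using ([]; _∷_)
open import Data.List.Relation.Unary.Any as Any using (Any; here; there)
import Data.List.Relation.Unary.Any.Properties as Any
open import Data.List.Relation.Unary.Unique.Propositional using (Unique)
import Data.List.Relation.Unary.Unique.Setoid as Unique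
import Data.List.Relation.Unary.Unique.Setoid.Properties as Unique
open import Data.Maybe.Base using (Maybe; just; nothing; maybe′)
open import Data.Maybe.Properties using (just-injective)
open import Data.Nat.Base as ℕ using (ℕ; zero; suc; NonZero; _!; _^_)
import Data.Nat.Properties as ℕ
open import Data.Nat.Properties using (_!≢0)
import Data.Nat.Solver as ℕ
open import Data.Product.Base using (Σ; ∃; _×_; _,_; proj₁; proj₂)
open import Data.Rational.Base using (ℚ; 0ℚ; 1ℚ; _+_; _*_; _/_; _≤_; _<_; toℚᵘ; nonNegative)
open import Data.Rational.Properties hiding (_≟_)
open import Data.Rational.Solver using (module +-*-Solver)
open import Data.Rational.Unnormalised.Base as ℚᵘ using (mkℚᵘ; *≡*)
import Data.Rational.Unnormalised.Properties as ℚᵘ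
open import Data.Sum.Base using (inj₁; inj₂)
open import Function.Base using (_∘_)
open import Function.Bundles using (_↔_; Inverse; Injection)
open import Function.Construct.Composition using (_↔-∘_)
open import Function.Construct.Symmetry using (↔-sym)
open import Function.Properties.Inverse using (↔⇒↣)
open import Level using (0ℓ)
open import Relation.Binary.Bundles using (Setoid)
open import Relation.Binary.PropositionalEquality using (_≡_; _≢_; refl; sym; trans; cong; cong₂; subst; subst₂; setoid; module ≡-Reasoning)
open import Relation.Nullary using (Dec; yes; no; ¬_; does; contradiction)
open import Relation.Nullary.Decidable using (decidable-stable)
open import Relation.Unary using (Pred; ∅)
open import Defs

-- Permutations

infix 4 _≗↔_

-- Only the forward maps are compared: a term of `A ↔ B` also carries an inverse and proofs, and
-- `⟦_⟧` tests local labelings in this same way.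
_≗↔_ : ∀ {A B : Set} (f g : A ↔ B) → Set
f ≗↔ g = ∀ x → Inverse.to f x ≡ Inverse.to g x

↔-setoid : (A B : Set) → Setoid 0ℓ 0ℓ
↔-setoid A B = record
  { Carrier       = A ↔ B
  ; _≈_           = _≗↔_
  ; isEquivalence = record
    { refl  = λ _ → refl
    ; sym   = λ eq x → sym (eq x)
    ; trans = λ eq₁ eq₂ x → trans (eq₁ x) (eq₂ x)
    }
  }

DistinctBijections : ∀ {A B : Set} → List (A ↔ B) → Set
DistinctBijections {A} {B} = Unique.Unique (↔-setoid A B)

length-cartesianProductWith : ∀ {A B C : Set} (f : A → B → C) xs ys →
  length (cartesianProductWith f xs ys) ≡ length xs ℕ.* length ys
length-cartesianProductWith f []       ys = refl
length-cartesianProductWith f (x ∷ xs) ys = trans (length-++ (map (f x) ys))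
  (cong₂ ℕ._+_ (length-map (f x) ys) (length-cartesianProductWith f xs ys))

insert-at : ∀ {n} i j (π : Permutation′ n) → insert i j π ⟨$⟩ʳ i ≡ j
insert-at i j π with i Fin.≟ i
... | yes _  = refl
... | no i≢i = contradiction refl i≢i

-- The value at `i` determines `j`; at the remaining points the common `punchIn j` can be cancelled.
insert-injective : ∀ {n} i {j k} {π ρ : Permutation′ n} →
                   insert i j π ≗↔ insert i k ρ → j ≡ k × π ≗↔ ρ
insert-injective i {j} {k} {π} {ρ} eq = j≡k , λ x → lemma j≡k x
  where
  j≡k : j ≡ k
  j≡k = trans (sym (insert-at i j π)) (trans (eq i) (insert-at i k ρ))

  lemma : j ≡ k → π ≗↔ ρ
  lemma refl x = punchIn-injective j _ _
    (trans (sym (insert-punchIn i j π x)) (trans (eq (punchIn i x)) (insert-punchIn i j ρ x)))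

insert-cong : ∀ {n} i {j k} {π ρ : Permutation′ n} →
              j ≡ k → π ≗↔ ρ → insert i j π ≗↔ insert i k ρ
insert-cong i {j} refl eq x with i Fin.≟ x
... | yes _ = refl
... | no _  = cong (punchIn j) (eq _)

insertions : ∀ {n} → Fin (suc n) → List (Fin (suc n)) → List (Permutation′ n) → List (Permutation′ (suc n))
insertions i = cartesianProductWith (insert i)

permutations : ∀ n → List (Permutation′ n)
permutations zero    = id ∷ []
permutations (suc n) = insertions zero (allFin (suc n)) (permutations n)

length-permutations : ∀ n → length (permutations n) ≡ n !
length-permutations zero    = refl
length-permutations (suc n) = trans
  (length-cartesianProductWith (insert zero) (allFin (suc n)) (permutations n))
  (cong₂ ℕ._*_ (length-tabulate {n = suc n} (λ i → i)) (length-permutations n))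

insertions-distinct : ∀ {n} i {js} {πs : List (Permutation′ n)} →
  Unique.Unique (setoid (Fin (suc n))) js → DistinctBijections πs → DistinctBijections (insertions i js πs)
insertions-distinct i = Unique.cartesianProductWith⁺ (setoid _) (↔-setoid _ _) (↔-setoid _ _)
  (insert i) (insert-injective i)

permutations-distinct : ∀ n → DistinctBijections (permutations n)
permutations-distinct zero    = [] ∷ []
permutations-distinct (suc n) = insertions-distinct zero
  (Unique.tabulate⁺ (setoid _) (λ eq → eq)) (permutations-distinct n)

permutations-complete : ∀ n (π : Permutation′ n) → Any (π ≗↔_) (permutations n)
permutations-complete zero    π = here λ ()
permutations-complete (suc n) π = Any.cartesianProductWith⁺ (insert zero)
  (λ eq₁ eq₂ x → trans (sym (insert-remove zero π x)) (insert-cong zero eq₁ eq₂ x))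
  (∈-allFin (π ⟨$⟩ʳ zero)) (permutations-complete n (remove zero π))


-- In `degᵀ-counts` the index `zero` of a non-root vertex is the arc to its parent. Composed with
-- it, these permutations become the local labelings whose port `i` leads to a child.
permutationsAvoidingZeroAt : ∀ {n} → Fin (suc n) → List (Permutation′ (suc n))
permutationsAvoidingZeroAt {n} i = insertions i (map suc (allFin n)) (permutations n)

length-permutationsAvoidingZeroAt : ∀ {n} i → length (permutationsAvoidingZeroAt {n} i) ≡ n ℕ.* n !
length-permutationsAvoidingZeroAt {n} i = trans
  (length-cartesianProductWith (insert i) (map suc (allFin n)) (permutations n))
  (cong₂ ℕ._*_ (trans (length-map suc (allFin n)) (length-tabulate {n = n} (λ j → j))) (length-permutations n))

permutationsAvoidingZeroAt-distinct : ∀ {n} i → DistinctBijections (permutationsAvoidingZeroAt {n} i)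
permutationsAvoidingZeroAt-distinct {n} i = insertions-distinct i
  (Unique.map⁺ (setoid _) (setoid _) suc-injective (Unique.tabulate⁺ (setoid _) (λ eq → eq)))
  (permutations-distinct n)

permutationsAvoidingZeroAt-sound : ∀ {n} i →
  All (λ π → ∃ λ j → π ⟨$⟩ʳ i ≡ suc j) (permutationsAvoidingZeroAt {n} i)
permutationsAvoidingZeroAt-sound i =
  All.cartesianProductWith⁺ (setoid _) (setoid _) (insert i) _ _ sound
  where
  sound : ∀ {k π} → k ∈ map suc (allFin _) → π ∈ permutations _ → ∃ λ j → insert i k π ⟨$⟩ʳ i ≡ suc j
  sound {π = π} k∈ _ with ∈-map⁻ suc k∈
  ... | j , _ , refl = j , insert-at i (suc j) π

-- Finite sums of rationals

fromℕ : ℕ → ℚ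
fromℕ n = + n / 1

private
  toℚᵘ-/ : ∀ i n .{{_ : NonZero n}} → toℚᵘ (i / n) ℚᵘ.≃ (i ℚᵘ./ n)
  toℚᵘ-/ i (suc n) = toℚᵘ-fromℚᵘ (mkℚᵘ i n)

fromℕ-+ : ∀ m n → fromℕ (m ℕ.+ n) ≡ fromℕ m + fromℕ n
fromℕ-+ m n = toℚᵘ-injective (begin
  toℚᵘ (fromℕ (m ℕ.+ n))             ≈⟨ toℚᵘ-/ _ 1 ⟩
  mkℚᵘ (+ (m ℕ.+ n)) 0               ≈⟨ *≡* (cong (ℤ._* + 1) (sym (cong₂ ℤ._+_ (ℤ.*-identityʳ (+ m)) (ℤ.*-identityʳ (+ n))))) ⟩
  mkℚᵘ (+ m) 0 ℚᵘ.+ mkℚᵘ (+ n) 0     ≈⟨ ℚᵘ.+-cong (toℚᵘ-/ (+ m) 1) (toℚᵘ-/ (+ n) 1) ⟨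
  toℚᵘ (fromℕ m) ℚᵘ.+ toℚᵘ (fromℕ n) ≈⟨ toℚᵘ-homo-+ (fromℕ m) (fromℕ n) ⟨
  toℚᵘ (fromℕ m + fromℕ n)           ∎)
  where open ℚᵘ.≃-Reasoning

fromℕ-* : ∀ m n → fromℕ (m ℕ.* n) ≡ fromℕ m * fromℕ n
fromℕ-* m n = toℚᵘ-injective (begin
  toℚᵘ (fromℕ (m ℕ.* n))             ≈⟨ toℚᵘ-/ _ 1 ⟩
  mkℚᵘ (+ (m ℕ.* n)) 0               ≈⟨ *≡* (cong (ℤ._* + 1) (ℤ.pos-* m n)) ⟩
  mkℚᵘ (+ m) 0 ℚᵘ.* mkℚᵘ (+ n) 0     ≈⟨ ℚᵘ.*-cong (toℚᵘ-/ (+ m) 1) (toℚᵘ-/ (+ n) 1) ⟨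
  toℚᵘ (fromℕ m) ℚᵘ.* toℚᵘ (fromℕ n) ≈⟨ toℚᵘ-homo-* (fromℕ m) (fromℕ n) ⟨
  toℚᵘ (fromℕ m * fromℕ n)           ∎)
  where open ℚᵘ.≃-Reasoning

fromℕ-inverse : ∀ n .{{_ : NonZero n}} → fromℕ n * (+ 1 / n) ≡ 1ℚ
fromℕ-inverse n@(suc _) = toℚᵘ-injective (begin
  toℚᵘ (fromℕ n * (+ 1 / n))           ≈⟨ toℚᵘ-homo-* (fromℕ n) (+ 1 / n) ⟩
  toℚᵘ (fromℕ n) ℚᵘ.* toℚᵘ (+ 1 / n)   ≈⟨ ℚᵘ.*-cong (toℚᵘ-/ (+ n) 1) (toℚᵘ-/ (+ 1) n) ⟩
  mkℚᵘ (+ n) 0 ℚᵘ.* (+ 1 ℚᵘ./ n)       ≈⟨ *≡* (trans (ℤ.*-assoc (+ n) (+ 1) (+ 1)) (trans (ℤ.*-identityʳ (+ n)) (sym (trans (ℤ.*-identityˡ _) (ℤ.*-identityˡ (+ n)))))) ⟩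
  toℚᵘ 1ℚ                              ∎)
  where open ℚᵘ.≃-Reasoning

0≤1/ : ∀ n .{{_ : NonZero n}} → 0ℚ ≤ + 1 / n
0≤1/ n = nonNegative⁻¹ (+ 1 / n) {{normalize-nonNeg 1 n}}

0≤fromℕ : ∀ n → 0ℚ ≤ fromℕ n
0≤fromℕ n = nonNegative⁻¹ (fromℕ n) {{normalize-nonNeg n 1}}

fromℕ-mono-≤ : ∀ {m n} → m ℕ.≤ n → fromℕ m ≤ fromℕ n
fromℕ-mono-≤ {m} {n} m≤n = subst (fromℕ m ≤_)
  (trans (sym (fromℕ-+ m (n ℕ.∸ m))) (cong fromℕ (ℕ.m+[n∸m]≡n m≤n)))
  (subst (_≤ fromℕ m + fromℕ (n ℕ.∸ m)) (+-identityʳ (fromℕ m))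
    (+-monoʳ-≤ (fromℕ m) (0≤fromℕ (n ℕ.∸ m))))

*-nonneg : ∀ {p q} → 0ℚ ≤ p → 0ℚ ≤ q → 0ℚ ≤ p * q
*-nonneg {p} {q} 0≤p 0≤q = subst (_≤ p * q) (*-zeroʳ p)
  (*-monoˡ-≤-nonNeg p {{nonNegative 0≤p}} 0≤q)

module _ {A : Set} where

  ∑ : (A → ℚ) → List A → ℚ
  ∑ f = foldr (λ x r → f x + r) 0ℚ

  ∑-nonneg : ∀ {f} → (∀ x → 0ℚ ≤ f x) → ∀ xs → 0ℚ ≤ ∑ f xs
  ∑-nonneg f≥0 []       = ≤-refl
  ∑-nonneg f≥0 (x ∷ xs) = +-mono-≤ (f≥0 x) (∑-nonneg f≥0 xs)

  ∑-mono : ∀ {f g} → (∀ x → f x ≤ g x) → ∀ xs → ∑ f xs ≤ ∑ g xs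
  ∑-mono f≤g []       = ≤-refl
  ∑-mono f≤g (x ∷ xs) = +-mono-≤ (f≤g x) (∑-mono f≤g xs)

  ∑-cong : ∀ {f g} → (∀ x → f x ≡ g x) → ∀ xs → ∑ f xs ≡ ∑ g xs
  ∑-cong f≡g []       = refl
  ∑-cong f≡g (x ∷ xs) = cong₂ _+_ (f≡g x) (∑-cong f≡g xs)

  ∑-*ˡ : ∀ c f xs → ∑ (λ x → c * f x) xs ≡ c * ∑ f xs
  ∑-*ˡ c f []       = sym (*-zeroʳ c)
  ∑-*ˡ c f (x ∷ xs) = trans (cong (λ r → c * f x + r) (∑-*ˡ c f xs)) (sym (*-distribˡ-+ c (f x) (∑ f xs)))

  ∑-+ : ∀ f g xs → ∑ (λ x → f x + g x) xs ≡ ∑ f xs + ∑ g xs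
  ∑-+ f g []       = refl
  ∑-+ f g (x ∷ xs) = trans (cong (λ r → (f x + g x) + r) (∑-+ f g xs))
    (solve 4 (λ a b c d → (a :+ b) :+ (c :+ d) := (a :+ c) :+ (b :+ d)) refl (f x) (g x) (∑ f xs) (∑ g xs))
    where open +-*-Solver

  ∑-const : ∀ c (xs : List A) → ∑ (λ _ → c) xs ≡ fromℕ (length xs) * c
  ∑-const c []       = sym (*-zeroˡ c)
  ∑-const c (x ∷ xs) = begin
    c + ∑ (λ _ → c) xs             ≡⟨ cong₂ _+_ (sym (*-identityˡ c)) (∑-const c xs) ⟩
    1ℚ * c + fromℕ (length xs) * c ≡⟨ *-distribʳ-+ c 1ℚ (fromℕ (length xs)) ⟨
    (1ℚ + fromℕ (length xs)) * c   ≡⟨ cong (_* c) (fromℕ-+ 1 (length xs)) ⟨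
    fromℕ (suc (length xs)) * c    ∎
    where open ≡-Reasoning

  ∑-const-< : ∀ {c f} {xs : List A} .{{_ : NonZero (length xs)}} →
              All (λ x → c < f x) xs → fromℕ (length xs) * c < ∑ f xs
  ∑-const-< {c} {f} {xs} c<f = subst (_< ∑ f xs) (∑-const c xs) (strict c<f)
    where
    weak : ∀ {xs} → All (λ x → c < f x) xs → ∑ (λ _ → c) xs ≤ ∑ f xs
    weak []       = ≤-refl
    weak (p ∷ ps) = +-mono-≤ (<⇒≤ p) (weak ps)

    strict : ∀ {xs} .{{_ : NonZero (length xs)}} → All (λ x → c < f x) xs → ∑ (λ _ → c) xs < ∑ f xs
    strict (p ∷ ps) = +-mono-<-≤ p (weak ps)

  term≤∑ : ∀ {f} → (∀ x → 0ℚ ≤ f x) → ∀ {x xs} → x ∈ xs → f x ≤ ∑ f xs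
  term≤∑ {f} f≥0 {x} {_ ∷ xs} (here refl) = subst (_≤ f x + ∑ f xs) (+-identityʳ (f x))
    (+-monoʳ-≤ (f x) (∑-nonneg f≥0 xs))
  term≤∑ {f} f≥0 {x} {y ∷ xs} (there x∈xs) = subst (_≤ f y + ∑ f xs) (+-identityˡ (f x))
    (+-mono-≤ (f≥0 y) (term≤∑ f≥0 x∈xs))

∑-swap : ∀ {A B : Set} (f : A → B → ℚ) xs ys →
         ∑ (λ x → ∑ (f x) ys) xs ≡ ∑ (λ y → ∑ (λ x → f x y) xs) ys
∑-swap f []       ys = sym (trans (∑-const 0ℚ ys) (*-zeroʳ (fromℕ (length ys))))
∑-swap f (x ∷ xs) ys = trans (cong (λ r → ∑ (f x) ys + r) (∑-swap f xs ys)) (sym (∑-+ (f x) (λ y → ∑ (λ x → f x y) xs) ys))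

-- A general `g` is needed for the induction, since the tail of `applyUpTo g` enumerates the values
-- of `g` shifted by one.
∑-applyUpTo-mono : ∀ {f : ℕ → ℚ} → (∀ k → 0ℚ ≤ f k) → ∀ g {m n} → m ℕ.≤ n →
                   ∑ f (applyUpTo g m) ≤ ∑ f (applyUpTo g n)
∑-applyUpTo-mono f≥0 g {n = n} ℕ.z≤n       = ∑-nonneg f≥0 (applyUpTo g n)
∑-applyUpTo-mono {f} f≥0 g     (ℕ.s≤s m≤n) = +-monoʳ-≤ (f (g 0)) (∑-applyUpTo-mono f≥0 (λ k → g (suc k)) m≤n)

∑-upTo-mono : ∀ {f : ℕ → ℚ} → (∀ k → 0ℚ ≤ f k) → ∀ {m n} → m ℕ.≤ n → ∑ f (upTo m) ≤ ∑ f (upTo n)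
∑-upTo-mono f≥0 = ∑-applyUpTo-mono f≥0 (λ k → k)

-- The maximum of the finitely many individual bounds works, by monotonicity.
common-bound : ∀ {A : Set} (P : A → ℕ → Set) → (∀ x {m n} → m ℕ.≤ n → P x m → P x n) →
               ∀ {xs} → All (λ x → ∃ (P x)) xs → ∃ λ n → All (λ x → P x n) xs
common-bound P mono []              = 0 , []
common-bound P mono ((m , Px) ∷ ps) =
  let n , Pxs = common-bound P mono ps in
  m ℕ.⊔ n , mono _ (ℕ.m≤m⊔n m n) Px ∷ All.map (mono _ (ℕ.m≤n⊔m m n)) Pxs

-- The finiteness of xs lets the bounds failing at each x fail at a common
-- index, where they contradict the bound on the sum.

some-below-average : ExcludedMiddle 0ℓ → ∀ {A : Set} (f : A → ℕ → ℚ) →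
  (∀ x {m n} → m ℕ.≤ n → f x m ≤ f x n) →
  ∀ xs .{{_ : NonZero (length xs)}} s →
  (∀ n → ∑ (λ x → f x n) xs ≤ fromℕ (length xs) * s) →
  Any (λ x → ∀ n → f x n ≤ s) xs
some-below-average em f mono xs s bound with em {Any (λ x → ∀ n → f x n ≤ s) xs}
... | yes found = found
... | no ¬found = contradiction (<-≤-trans (∑-const-< (proj₂ large)) (bound (proj₁ large))) (<-irrefl refl)
  where
  exceeds : ∀ {x} → ¬ (∀ n → f x n ≤ s) → ∃ λ n → s < f x n
  exceeds {x} ¬below with em {∃ λ n → s < f x n}
  ... | yes above = above
  ... | no ¬above = contradiction (λ n → ≮⇒≥ (λ s<f → ¬above (n , s<f))) ¬below

  large : ∃ λ n → All (λ x → s < f x n) xs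
  large = common-bound (λ x n → s < f x n) (λ x m≤n s<f → <-≤-trans s<f (mono x m≤n))
    (All.map exceeds (All.¬Any⇒All¬ xs ¬found))

-- Conditional masses of cylinders

relabel-distinct : ∀ {A B C : Set} (e : B ↔ C) {πs : List (A ↔ B)} →
                   DistinctBijections πs → DistinctBijections (map (e ↔-∘_) πs)
relabel-distinct e = Unique.map⁺ (↔-setoid _ _) (↔-setoid _ _)
  (λ eq x → Injection.injective (↔⇒↣ e) (eq x))

indicator : {P : Set} → Dec P → ℚ
indicator P? = if does P? then 1ℚ else 0ℚ

0≤indicator : {P : Set} (P? : Dec P) → 0ℚ ≤ indicator P?
0≤indicator (yes _) = 0≤fromℕ 1
0≤indicator (no _)  = ≤-refl

indicator-false : {P : Set} (P? : Dec P) → ¬ P → indicator P? ≡ 0ℚ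
indicator-false (yes p) ¬p = contradiction p ¬p
indicator-false (no _)  _  = refl

indicator-true : {P : Set} (P? : Dec P) → P → indicator P? ≡ 1ℚ
indicator-true (yes _) _ = refl
indicator-true (no ¬p) p = contradiction p ¬p

-- Two entries matching `σ` would agree with each other, which distinctness excludes.
∑-indicator≤1 : ∀ {A B : Set} (_≟_ : (π σ : A ↔ B) → Dec (π ≗↔ σ)) {πs : List (A ↔ B)} →
                DistinctBijections πs → ∀ σ → ∑ (λ π → indicator (π ≟ σ)) πs ≤ 1ℚ
∑-indicator≤1 _≟_ {[]}     []       σ = 0≤fromℕ 1
∑-indicator≤1 _≟_ {π ∷ πs} (π∉ ∷ d) σ with π ≟ σ
... | yes π≈σ = ≤-reflexive (trans (cong (λ r → 1ℚ + r) (none πs π∉)) (+-identityʳ 1ℚ))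
  where
  none : ∀ τs → All (λ τ → ¬ (π ≗↔ τ)) τs → ∑ (λ τ → indicator (τ ≟ σ)) τs ≡ 0ℚ
  none []       []       = refl
  none (τ ∷ τs) (n ∷ ns) = cong₂ _+_
    (indicator-false (τ ≟ σ) (λ τ≈σ → n (λ x → trans (π≈σ x) (sym (τ≈σ x))))) (none τs ns)
... | no _    = subst (_≤ 1ℚ) (sym (+-identityˡ (∑ (λ π → indicator (π ≟ σ)) πs)))
  (∑-indicator≤1 _≟_ d σ)

module _ (G : Graph) where
  open Graph G

  localLabelings : ∀ v → List (LocalLabeling G v)
  localLabelings v = map (deg-counts v ↔-∘_) (permutations (deg v))

  length-localLabelings : ∀ v → length (localLabelings v) ≡ deg v !
  length-localLabelings v = trans (length-map _ (permutations (deg v))) (length-permutations (deg v))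

  localLabelings-distinct : ∀ v → DistinctBijections (localLabelings v)
  localLabelings-distinct v = relabel-distinct (deg-counts v) (permutations-distinct (deg v))

module Conditioning (em : ExcludedMiddle 0ℓ) (G : Graph) where
  open Graph G

  PartialLabeling : Set
  PartialLabeling = ∀ v → Maybe (LocalLabeling G v)

  infix 4 _⊑_

  _⊑_ : PartialLabeling → PartialLabeling → Set
  ρ ⊑ ρ′ = ∀ {v π} → ρ v ≡ just π → ρ′ v ≡ just π

  Defined : PartialLabeling → Vertex → Set
  Defined ρ v = ∃ λ π → ρ v ≡ just π

  -- Vertices of a general graph need not have decidable equality, so `em` decides it.
  update : PartialLabeling → ∀ v → LocalLabeling G v → PartialLabeling
  update ρ v π w with em {v ≡ w}
  ... | yes refl = just π
  ... | no _     = ρ w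

  update-same : ∀ ρ v π → update ρ v π v ≡ just π
  update-same ρ v π with em {v ≡ v}
  ... | yes refl = refl
  ... | no v≢v   = contradiction refl v≢v

  update-other : ∀ ρ v π {w} → v ≢ w → update ρ v π w ≡ ρ w
  update-other ρ v π {w} v≢w with em {v ≡ w}
  ... | yes v≡w = contradiction v≡w v≢w
  ... | no _    = refl

  ⊑-update : ∀ ρ v π → ρ v ≡ nothing → ρ ⊑ update ρ v π
  ⊑-update ρ v π ρv {w} {σ} ρw with em {v ≡ w}
  ... | yes refl = contradiction (trans (sym ρv) ρw) λ ()
  ... | no _     = ρw

  1/deg! : Vertex → ℚ
  1/deg! v = (+ 1 / (deg v !)) {{deg v !≢0}}

  -- The conditional probability that the local labeling at `v` is `σ`: uniform while `v` is
  -- unrevealed, 0 or 1 afterwards.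
  weight : ∀ {v} → Maybe (LocalLabeling G v) → LocalLabeling G v → ℚ
  weight {v} nothing  σ = 1/deg! v
  weight     (just π) σ = indicator (em {π ≗↔ σ})

  0≤weight : ∀ {v} π (σ : LocalLabeling G v) → 0ℚ ≤ weight π σ
  0≤weight {v} nothing  σ = 0≤1/ (deg v !) {{deg v !≢0}}
  0≤weight     (just π) σ = 0≤indicator (em {π ≗↔ σ})

  Prescription : Set
  Prescription = List (Σ Vertex (LocalLabeling G))

  -- The conditional probability of the cylinder prescribing xs, given the
  -- values of ρ.

  condMass : PartialLabeling → Prescription → ℚ
  condMass ρ = foldr (λ (v , σ) r → weight (ρ v) σ * r) 1ℚ

  0≤condMass : ∀ ρ xs → 0ℚ ≤ condMass ρ xs
  0≤condMass ρ []             = 0≤fromℕ 1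
  0≤condMass ρ ((v , σ) ∷ xs) = *-nonneg (0≤weight (ρ v) σ) (0≤condMass ρ xs)

  condMass-update-∉ : ∀ ρ v π xs → All (v ≢_) (map proj₁ xs) →
                      condMass (update ρ v π) xs ≡ condMass ρ xs
  condMass-update-∉ ρ v π []             []         = refl
  condMass-update-∉ ρ v π ((w , σ) ∷ xs) (v≢w ∷ v∉) = cong₂ _*_
    (cong (λ m → weight m σ) (update-other ρ v π v≢w)) (condMass-update-∉ ρ v π xs v∉)

  condMass-determined : ∀ (ω : Labeling G) ρ xs →
    All (λ (v , σ) → ρ v ≡ just (ω v)) xs → All (λ (v , σ) → ω v ≗↔ σ) xs → condMass ρ xs ≡ 1ℚ
  condMass-determined ω ρ []             []        []        = refl
  condMass-determined ω ρ ((v , σ) ∷ xs) (eq ∷ eqs) (m ∷ ms) = cong₂ _*_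
    (trans (cong (λ m → weight m σ) eq) (indicator-true (em {ω v ≗↔ σ}) m))
    (condMass-determined ω ρ xs eqs ms)

  -- The prescribed vertices are distinct, so at most one factor depends on `π`. That factor is an
  -- indicator, and its sum over distinct candidates is at most 1, which is `deg v !` times the
  -- former factor `1/deg! v`. All other factors are pulled out of the sum; if none depends on `π`,
  -- the bound on the number of candidates suffices.
  ∑-condMass-update : ∀ ρ v → ρ v ≡ nothing → ∀ {πs} → DistinctBijections πs →
    length πs ℕ.≤ deg v ! → ∀ xs → Unique (map proj₁ xs) →
    ∑ (λ π → condMass (update ρ v π) xs) πs ≤ fromℕ (deg v !) * condMass ρ xs
  ∑-condMass-update ρ v ρv {πs} d len [] [] = subst (_≤ fromℕ (deg v !) * 1ℚ) (sym (∑-const 1ℚ πs))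
    (*-monoʳ-≤-nonNeg 1ℚ (fromℕ-mono-≤ len))
  ∑-condMass-update ρ v ρv {πs} d len ((w , σ) ∷ xs) (w∉ ∷ u) = split (em {v ≡ w})
    where
    open ≤-Reasoning

    split : Dec (v ≡ w) → ∑ (λ π → condMass (update ρ v π) ((w , σ) ∷ xs)) πs ≤
                          fromℕ (deg v !) * condMass ρ ((w , σ) ∷ xs)
    split (yes refl) = begin
      ∑ (λ π → weight (update ρ v π v) σ * condMass (update ρ v π) xs) πs
        ≡⟨ ∑-cong (λ π → trans (cong₂ _*_ (cong (λ m → weight m σ) (update-same ρ v π)) (condMass-update-∉ ρ v π xs w∉))
                    (*-comm (indicator (em {π ≗↔ σ})) (condMass ρ xs))) πs ⟩
      ∑ (λ π → condMass ρ xs * indicator (em {π ≗↔ σ})) πs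
        ≡⟨ ∑-*ˡ (condMass ρ xs) (λ π → indicator (em {π ≗↔ σ})) πs ⟩
      condMass ρ xs * ∑ (λ π → indicator (em {π ≗↔ σ})) πs
        ≤⟨ *-monoˡ-≤-nonNeg (condMass ρ xs) {{nonNegative (0≤condMass ρ xs)}}
             (∑-indicator≤1 (λ π σ → em {π ≗↔ σ}) d σ) ⟩
      condMass ρ xs * 1ℚ
        ≡⟨ *-comm (condMass ρ xs) 1ℚ ⟩
      1ℚ * condMass ρ xs
        ≡⟨ cong (_* condMass ρ xs) (fromℕ-inverse (deg v !) {{deg v !≢0}}) ⟨
      fromℕ (deg v !) * 1/deg! v * condMass ρ xs
        ≡⟨ *-assoc (fromℕ (deg v !)) (1/deg! v) (condMass ρ xs) ⟩
      fromℕ (deg v !) * (1/deg! v * condMass ρ xs)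
        ≡⟨ cong (λ m → fromℕ (deg v !) * (weight m σ * condMass ρ xs)) ρv ⟨
      fromℕ (deg v !) * (weight (ρ v) σ * condMass ρ xs) ∎

    split (no v≢w) = begin
      ∑ (λ π → weight (update ρ v π w) σ * condMass (update ρ v π) xs) πs
        ≡⟨ ∑-cong (λ π → cong (λ m → weight m σ * condMass (update ρ v π) xs) (update-other ρ v π v≢w)) πs ⟩
      ∑ (λ π → weight (ρ w) σ * condMass (update ρ v π) xs) πs
        ≡⟨ ∑-*ˡ (weight (ρ w) σ) (λ π → condMass (update ρ v π) xs) πs ⟩
      weight (ρ w) σ * ∑ (λ π → condMass (update ρ v π) xs) πs
        ≤⟨ *-monoˡ-≤-nonNeg (weight (ρ w) σ) {{nonNegative (0≤weight (ρ w) σ)}}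
             (∑-condMass-update ρ v ρv d len xs u) ⟩
      weight (ρ w) σ * (fromℕ (deg v !) * condMass ρ xs)
        ≡⟨ *-assoc (weight (ρ w) σ) (fromℕ (deg v !)) (condMass ρ xs) ⟨
      weight (ρ w) σ * fromℕ (deg v !) * condMass ρ xs
        ≡⟨ cong (_* condMass ρ xs) (*-comm (weight (ρ w) σ) (fromℕ (deg v !))) ⟩
      fromℕ (deg v !) * weight (ρ w) σ * condMass ρ xs
        ≡⟨ *-assoc (fromℕ (deg v !)) (weight (ρ w) σ) (condMass ρ xs) ⟩
      fromℕ (deg v !) * (weight (ρ w) σ * condMass ρ xs) ∎

  module _ (C : CylinderSeq G) where

    term : PartialLabeling → ℕ → ℚ
    term ρ k = maybe′ (λ c → condMass ρ (Cylinder.prescribed c)) 0ℚ (C k)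

    0≤term : ∀ ρ k → 0ℚ ≤ term ρ k
    0≤term ρ k with C k
    ... | just c  = 0≤condMass ρ (Cylinder.prescribed c)
    ... | nothing = ≤-refl

    ∑-term-update : ∀ ρ v → ρ v ≡ nothing → ∀ {πs} → DistinctBijections πs → length πs ℕ.≤ deg v ! →
                    ∀ k → ∑ (λ π → term (update ρ v π) k) πs ≤ fromℕ (deg v !) * term ρ k
    ∑-term-update ρ v ρv {πs} d len k with C k
    ... | just c  = ∑-condMass-update ρ v ρv d len (Cylinder.prescribed c) (Cylinder.distinct c)
    ... | nothing = ≤-reflexive (trans (trans (∑-const 0ℚ πs) (*-zeroʳ (fromℕ (length πs)))) (sym (*-zeroʳ (fromℕ (deg v !)))))

    -- A bound on the infinite series of conditional masses, expressed through its partial sums. The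
    -- empty partial sum gives `0ℚ ≤ s`.
    CondMass≤ : PartialLabeling → ℚ → Set
    CondMass≤ ρ s = ∀ K → ∑ (term ρ) (upTo K) ≤ s

    -- Interchanging the sums bounds the average over the candidates by `deg v !` divided by
    -- `length πs`, times `s`. Restricting to few candidates thus costs exactly this ratio, and one
    -- candidate serves all partial sums at once.
    extend-at : ∀ ρ v → ρ v ≡ nothing → ∀ {πs} .{{_ : NonZero (length πs)}} →
      DistinctBijections πs → length πs ℕ.≤ deg v ! →
      ∀ {s s′} → fromℕ (deg v !) * s ≤ fromℕ (length πs) * s′ →
      CondMass≤ ρ s → Any (λ π → CondMass≤ (update ρ v π) s′) πs
    extend-at ρ v ρv {πs} d len {s} {s′} s≤s′ ρ≤s =
      some-below-average em (λ π K → ∑ (term (update ρ v π)) (upTo K))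
        (λ π → ∑-upTo-mono (0≤term (update ρ v π))) πs s′ λ K → begin
          ∑ (λ π → ∑ (term (update ρ v π)) (upTo K)) πs ≡⟨ ∑-swap (λ π → term (update ρ v π)) πs (upTo K) ⟩
          ∑ (λ k → ∑ (λ π → term (update ρ v π) k) πs) (upTo K) ≤⟨ ∑-mono (∑-term-update ρ v ρv d len) (upTo K) ⟩
          ∑ (λ k → fromℕ (deg v !) * term ρ k) (upTo K) ≡⟨ ∑-*ˡ (fromℕ (deg v !)) (term ρ) (upTo K) ⟩
          fromℕ (deg v !) * ∑ (term ρ) (upTo K) ≤⟨ *-monoˡ-≤-nonNeg (fromℕ (deg v !)) {{nonNegative (0≤fromℕ (deg v !))}} (ρ≤s K) ⟩
          fromℕ (deg v !) * s ≤⟨ s≤s′ ⟩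
          fromℕ (length πs) * s′ ∎
      where open ≤-Reasoning

    -- With all `deg v !` labelings as candidates the ratio is 1, so `s` does not grow. Vertices
    -- that are already defined keep their labels, which protects the choice made at the path
    -- vertex.
    extend-all : ∀ ρ {s} → CondMass≤ ρ s → ∀ vs → ∃ λ ρ′ → CondMass≤ ρ′ s × (ρ ⊑ ρ′) ×
                 All (Defined ρ′) vs × (∀ w → w ∉ vs → ρ′ w ≡ ρ w)
    extend-all ρ ρ≤s [] = ρ , ρ≤s , (λ eq → eq) , [] , (λ _ _ → refl)
    extend-all ρ {s} ρ≤s (v ∷ vs) with extend-all ρ ρ≤s vs
    ... | ρ′ , ρ′≤s , ρ⊑ρ′ , def , same with ρ′ v in ρ′v
    ...   | just π  = ρ′ , ρ′≤s , ρ⊑ρ′ , (π , ρ′v) ∷ def , (λ w w∉ → same w (w∉ ∘ there))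
    ...   | nothing =
      let π , ρ″≤s = Any.satisfied (extend-at ρ′ v ρ′v {{subst NonZero (sym len) (deg v !≢0)}}
                       (localLabelings-distinct G v) (ℕ.≤-reflexive len)
                       (≤-reflexive (cong (λ n → fromℕ n * s) (sym len))) ρ′≤s)
          ⊑ = λ {w} {σ} → ⊑-update ρ′ v π ρ′v {w} {σ}
      in update ρ′ v π , ρ″≤s , (λ eq → ⊑ (ρ⊑ρ′ eq)) ,
         (π , update-same ρ′ v π) ∷ All.map (λ (σ , eq) → σ , ⊑ eq) def ,
         (λ w w∉ → trans (update-other ρ′ v π (λ v≡w → w∉ (here (sym v≡w)))) (same w (w∉ ∘ there)))
      where
      len = length-localLabelings G v

    avoids : ∀ (ω : Labeling G) ρ {s} → CondMass≤ ρ s → s < 1ℚ → ∀ k {c} → C k ≡ just c →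
             All (λ (v , _) → ρ v ≡ just (ω v)) (Cylinder.prescribed c) → ¬ ⟦_⟧ G c ω
    avoids ω ρ {s} ρ≤s s<1 k {c} Ck det ω∈c = <-irrefl refl (begin-strict
      1ℚ                             ≡⟨ condMass-determined ω ρ (Cylinder.prescribed c) det ω∈c ⟨
      condMass ρ (Cylinder.prescribed c) ≡⟨ cong (maybe′ (λ c → condMass ρ (Cylinder.prescribed c)) 0ℚ) Ck ⟨
      term ρ k                       ≤⟨ term≤∑ (0≤term ρ) (∈-upTo⁺ (ℕ.n<1+n k)) ⟩
      ∑ (term ρ) (upTo (suc k))      ≤⟨ ρ≤s (suc k) ⟩
      s                              <⟨ s<1 ⟩
      1ℚ                             ∎)
      where open ≤-Reasoning

-- Measurability of the escape event

localLabelings-complete : ∀ G v (π : LocalLabeling G v) → Any (π ≗↔_) (localLabelings G v)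
localLabelings-complete G v π = Any.map⁺ (Any.map
  (λ eq x → trans (sym (Inverse.strictlyInverseˡ (Graph.deg-counts G v) (Inverse.to π x)))
                  (cong (Inverse.to (Graph.deg-counts G v)) (eq x)))
  (permutations-complete _ (↔-sym (Graph.deg-counts G v) ↔-∘ π)))

-- After the latest of the times at which the walk leaves the members of `vs` for good, it is
-- outside `vs`.
finitelyOften⇒unbounded : ∀ G v₀ (ℓ : Port G v₀) ω →
  (∀ v → ∃ λ N → ∀ n → N ℕ.≤ n → position G ω v₀ ℓ n ≢ v) →
  ∀ vs → ∃ λ n → position G ω v₀ ℓ n ∉ vs
finitelyOften⇒unbounded G v₀ ℓ ω finite vs =
  let N , left = common-bound (λ v N → ∀ n → N ℕ.≤ n → position G ω v₀ ℓ n ≢ v)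
                   (λ v M≤N left n N≤n → left n (ℕ.≤-trans M≤N N≤n))
                   (All.tabulate {xs = vs} λ {v} _ → finite v)
  in N , λ pos∈vs → All.lookup left pos∈vs N ℕ.≤-refl refl

module Measurability (em : ExcludedMiddle 0ℓ) (G : Graph) where
  open Graph G

  private
    Event : Set₁
    Event = Pred (Labeling G) 0ℓ

  measurable-const : (P : Set) → Measurable G (λ _ → P)
  measurable-const P = decide em
    where
    everything : Cylinder G
    everything = record { prescribed = [] ; distinct = [] }

    decide : Dec P → Measurable G (λ _ → P)
    decide (yes p) = resp-≐ ((λ _ → p) , (λ _ → [])) (cylinder everything)
    decide (no ¬p) = resp-≐ ((λ ¬[] → contradiction [] ¬[]) , (λ p → contradiction p ¬p))
      (complement (cylinder everything))

  -- A countable intersection by De Morgan, with `em` removing the double negation.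
  measurable-∀ : ∀ {A : ℕ → Event} → (∀ n → Measurable G (A n)) → Measurable G (λ ω → ∀ n → A n ω)
  measurable-∀ mA = resp-≐
    ((λ ¬∃ n → decidable-stable em (λ ¬An → ¬∃ (n , ¬An))) , (λ all (n , ¬An) → ¬An (all n)))
    (complement (union (λ n → complement (mA n))))

  measurable-Any : ∀ {X : Set} {A : X → Event} → (∀ x → Measurable G (A x)) →
                   ∀ xs → Measurable G (λ ω → Any (λ x → A x ω) xs)
  measurable-Any         mA []       = resp-≐ ((λ ()) , (λ ())) (measurable-const ⊥)
  -- A binary union is encoded as a countable one: the sequence has the head at index 0 and the tail
  -- at every later index.
  measurable-Any {A = A} mA (x ∷ xs) = resp-≐
    ((λ { (zero , a) → here a ; (suc _ , as) → there as }) , (λ { (here a) → 0 , a ; (there as) → 1 , as }))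
    (union {A = λ { zero → A x ; (suc _) ω → Any (λ x → A x ω) xs } }
      λ { zero → mA x ; (suc _) → measurable-Any mA xs })

  measurable-× : ∀ {A B : Event} → Measurable G A → Measurable G B → Measurable G (λ ω → A ω × B ω)
  measurable-× {A} {B} mA mB = resp-≐
    ((λ f → f 0 , f 1) , (λ { (a , b) zero → a ; (a , b) (suc _) → b }))
    (measurable-∀ {A = λ { zero → A ; (suc _) → B } } λ { zero → mA ; (suc _) → mB })

  -- There are finitely many local labelings at `v`, so the event is a finite union of one-vertex
  -- cylinders, each met with a constant event.
  measurable-arc : ∀ v p (Q : ∃ (v ⟶_) → Set) → Measurable G (λ ω → Q (Inverse.to (ω v) p))
  measurable-arc v p Q = resp-≐
    ( (λ {ω} → sound ω ∘ Any.satisfied)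
    , (λ {ω} Qω → Any.map (λ ω≈π → subst Q (ω≈π p) Qω , ω≈π ∷ []) (localLabelings-complete G v (ω v))) )
    (measurable-Any (λ π → measurable-× (measurable-const (Q (Inverse.to π p))) (cylinder (single π)))
      (localLabelings G v))
    where
    single : LocalLabeling G v → Cylinder G
    single π = record { prescribed = (v , π) ∷ [] ; distinct = [] ∷ [] }

    sound : ∀ ω →
            ∃ (λ π → Q (Inverse.to π p) × ⟦_⟧ G (single π) ω) → Q (Inverse.to (ω v) p)
    sound ω (π , Qπ , (ω≈π ∷ [])) = subst Q (sym (ω≈π p)) Qπ

  module _ (vertices : ℕ → List Vertex) (exhaustive : ∀ v → ∃ λ n → v ∈ vertices n) where

    -- The exhaustion by finite lists turns the union over all vertices into a countable union of
    -- finite ones.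
    measurable-∃Vertex : ∀ {A : Vertex → Event} → (∀ v → Measurable G (A v)) →
                         Measurable G (λ ω → ∃ λ v → A v ω)
    measurable-∃Vertex mA = resp-≐
      ( (λ (n , found) → Any.satisfied found)
      , (λ (v , a) → let n , v∈ = exhaustive v in n , lose v∈ a) )
      (union (λ n → measurable-Any mA (vertices n)))

    measurable-∀Vertex : ∀ {A : Vertex → Event} → (∀ v → Measurable G (A v)) →
                         Measurable G (λ ω → ∀ v → A v ω)
    measurable-∀Vertex mA = resp-≐
      ((λ ¬∃ v → decidable-stable em (λ ¬Av → ¬∃ (v , ¬Av))) , (λ all (v , ¬Av) → ¬Av (all v)))
      (complement (measurable-∃Vertex (λ v → complement (mA v))))

    -- Induction on time: split by the state `(v , p)` after `n` steps, of which there are countably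
    -- many. Given that state, the next one depends only on the arc at port `p` of `v`.
    measurable-walk : ∀ s n (Q : State G → Set) → Measurable G (λ ω → Q (walk G ω s n))
    measurable-walk s zero    Q = measurable-const (Q s)
    measurable-walk s (suc n) Q = resp-≐
      ( (λ {ω} (v , found) → sound ω v (Any.satisfied found))
      , (λ {ω} Qω → _ , lose (∈-allFin (proj₂ (walk G ω s n))) (refl , Qω)) )
      (measurable-∃Vertex λ v → measurable-Any
        (λ p → measurable-× (measurable-walk s n (_≡ (v , p)))
                 (measurable-arc v p (λ a → Q (proj₁ a , nextPort G p (proj₁ a)))))
        (allFin (deg v)))
      where
      sound : ∀ ω v → ∃ (λ p → walk G ω s n ≡ (v , p) × Q (step G ω (v , p))) → Q (walk G ω s (suc n))
      sound ω v (p , eq , Qvp) = subst (Q ∘ step G ω) (sym eq) Qvp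

    measurable-escape : ∀ v₀ ℓ → Measurable G (EscapesToInfinity G v₀ ℓ)
    measurable-escape v₀ ℓ = resp-≐
      ((λ {ω} finite → finitelyOften⇒unbounded G v₀ ℓ ω finite , finite) , proj₂)
      (measurable-∀Vertex λ v → union λ N → measurable-∀ λ n →
        measurable-walk (v₀ , ℓ) n (λ s → N ℕ.≤ n → proj₁ s ≢ v))

-- Descending walks on the tree

-- A path vertex with x children uses up a factor x / (x + 1) of the total
-- mass, and x ↦ x / (x + 4) bounds from below the product of these factors
-- over x, 2x, 4x, … for x ≥ 2.

Admissible : ℕ → ℚ → Set
Admissible x s = fromℕ (4 ℕ.+ x) * s < fromℕ x

admissible⇒<1 : ∀ x {s} → Admissible x s → s < 1ℚ
admissible⇒<1 x {s} s< = *-cancelˡ-<-nonNeg (fromℕ (4 ℕ.+ x)) {{nonNegative (0≤fromℕ (4 ℕ.+ x))}}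
  (<-≤-trans s< (subst (fromℕ x ≤_) (sym (*-identityʳ (fromℕ (4 ℕ.+ x)))) (fromℕ-mono-≤ (ℕ.m≤n+m x 4))))

-- Here `s′` is `s` times b/a. The numerical hypothesis is b/a · x/(x+4) ≤ 2x/(2x+4) cleared of
-- denominators, so the bound for `x` passes to the bound for `2 * x`.
admissible-double : ∀ x {s s′} → 0ℚ ≤ s → ∀ a b .{{_ : NonZero a}} →
  fromℕ a * s′ ≡ fromℕ b * s → (4 ℕ.+ 2 ℕ.* x) ℕ.* b ℕ.≤ 2 ℕ.* a ℕ.* (4 ℕ.+ x) →
  Admissible x s → Admissible (2 ℕ.* x) s′
admissible-double x {s} {s′} 0≤s a b as′≡bs ineq s< =
  *-cancelˡ-<-nonNeg (fromℕ a) {{nonNegative (0≤fromℕ a)}} (begin-strict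
    fromℕ a * (fromℕ y * s′)                ≡⟨ solve 3 (λ a y s → a :* (y :* s) := y :* (a :* s)) refl (fromℕ a) (fromℕ y) s′ ⟩
    fromℕ y * (fromℕ a * s′)                ≡⟨ cong (fromℕ y *_) as′≡bs ⟩
    fromℕ y * (fromℕ b * s)                 ≡⟨ *-assoc (fromℕ y) (fromℕ b) s ⟨
    fromℕ y * fromℕ b * s                   ≡⟨ cong (_* s) (fromℕ-* y b) ⟨
    fromℕ (y ℕ.* b) * s                     ≤⟨ *-monoʳ-≤-nonNeg s {{nonNegative 0≤s}} (fromℕ-mono-≤ ineq) ⟩
    fromℕ (2 ℕ.* a ℕ.* (4 ℕ.+ x)) * s       ≡⟨ cong (_* s) (fromℕ-* (2 ℕ.* a) (4 ℕ.+ x)) ⟩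
    fromℕ (2 ℕ.* a) * fromℕ (4 ℕ.+ x) * s   ≡⟨ *-assoc (fromℕ (2 ℕ.* a)) (fromℕ (4 ℕ.+ x)) s ⟩
    fromℕ (2 ℕ.* a) * (fromℕ (4 ℕ.+ x) * s) <⟨ *-monoʳ-<-pos (fromℕ (2 ℕ.* a)) {{normalize-pos (2 ℕ.* a) 1 {{_}} {{ℕ.m*n≢0 2 a}}}} s< ⟩
    fromℕ (2 ℕ.* a) * fromℕ x               ≡⟨ fromℕ-* (2 ℕ.* a) x ⟨
    fromℕ (2 ℕ.* a ℕ.* x)                   ≡⟨ cong fromℕ (ℕS.solve 2 (λ a x → (ℕS.con 2 ℕS.:* a ℕS.:* x) ℕS.:= (a ℕS.:* (ℕS.con 2 ℕS.:* x))) refl a x) ⟩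
    fromℕ (a ℕ.* (2 ℕ.* x))                 ≡⟨ fromℕ-* a (2 ℕ.* x) ⟩
    fromℕ a * fromℕ (2 ℕ.* x)               ∎)
  where
  open ≤-Reasoning
  open +-*-Solver
  module ℕS = ℕ.+-*-Solver
  y = 4 ℕ.+ 2 ℕ.* x

-- Of the (x+1)! labelings, x · x! send the walk down, so the mass bound grows by the factor
-- (x+1)/x.
admissible-rescale : ∀ x .{{_ : NonZero x}} → 2 ℕ.≤ x → ∀ {s} → 0ℚ ≤ s → Admissible x s →
  ∃ λ s′ → fromℕ (suc x !) * s ≡ fromℕ (x ℕ.* x !) * s′ × Admissible (2 ℕ.* x) s′
admissible-rescale x 2≤x {s} 0≤s s< = s′ , exact , admissible-double x 0≤s x (suc x) scale (ineq x 2≤x) s<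
  where
  open ≡-Reasoning
  open +-*-Solver
  s′ = fromℕ (suc x) * (+ 1 / x) * s

  scale : fromℕ x * s′ ≡ fromℕ (suc x) * s
  scale = begin
    fromℕ x * (fromℕ (suc x) * (+ 1 / x) * s) ≡⟨ solve 4 (λ x y r s → x :* (y :* r :* s) := x :* r :* (y :* s)) refl (fromℕ x) (fromℕ (suc x)) (+ 1 / x) s ⟩
    fromℕ x * (+ 1 / x) * (fromℕ (suc x) * s) ≡⟨ cong (_* (fromℕ (suc x) * s)) (fromℕ-inverse x) ⟩
    1ℚ * (fromℕ (suc x) * s)                  ≡⟨ *-identityˡ (fromℕ (suc x) * s) ⟩
    fromℕ (suc x) * s                         ∎

  exact : fromℕ (suc x !) * s ≡ fromℕ (x ℕ.* x !) * s′
  exact = begin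
    fromℕ (suc x ℕ.* x !) * s         ≡⟨ cong (_* s) (fromℕ-* (suc x) (x !)) ⟩
    fromℕ (suc x) * fromℕ (x !) * s   ≡⟨ solve 3 (λ a b s → a :* b :* s := b :* (a :* s)) refl (fromℕ (suc x)) (fromℕ (x !)) s ⟩
    fromℕ (x !) * (fromℕ (suc x) * s) ≡⟨ cong (fromℕ (x !) *_) scale ⟨
    fromℕ (x !) * (fromℕ x * s′)      ≡⟨ solve 3 (λ a b s → b :* (a :* s) := a :* b :* s) refl (fromℕ x) (fromℕ (x !)) s′ ⟩
    fromℕ x * fromℕ (x !) * s′        ≡⟨ cong (_* s′) (fromℕ-* x (x !)) ⟨
    fromℕ (x ℕ.* x !) * s′            ∎

  -- The right side exceeds the left by 2x - 4, which is `2 * y` for x = y + 2; this is where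
  -- `2 ≤ x` enters.
  ineq : ∀ x → 2 ℕ.≤ x → (4 ℕ.+ 2 ℕ.* x) ℕ.* suc x ℕ.≤ 2 ℕ.* x ℕ.* (4 ℕ.+ x)
  ineq (suc (suc y)) (ℕ.s≤s (ℕ.s≤s ℕ.z≤n)) = ℕ.≤-trans (ℕ.m≤m+n _ (2 ℕ.* y)) (ℕ.≤-reflexive
    (ℕS.solve 1 (λ y → (ℕS.con 4 ℕS.:+ ℕS.con 2 ℕS.:* (ℕS.con 2 ℕS.:+ y)) ℕS.:* (ℕS.con 3 ℕS.:+ y) ℕS.:+ ℕS.con 2 ℕS.:* y
      ℕS.:= ℕS.con 2 ℕS.:* (ℕS.con 2 ℕS.:+ y) ℕS.:* (ℕS.con 4 ℕS.:+ (ℕS.con 2 ℕS.:+ y))) refl y))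
    where module ℕS = ℕ.+-*-Solver

-- Enumeration of the tree by levels

verticesUpTo : ℕ → List TVertex
verticesUpTo zero    = root ∷ []
verticesUpTo (suc n) = root ∷ concatMap (λ v → map (child v) (allFin _)) (verticesUpTo n)

∈-verticesUpTo : ∀ v {n} → level v ℕ.≤ n → v ∈ verticesUpTo n
∈-verticesUpTo root        {zero}  _           = here refl
∈-verticesUpTo root        {suc n} _           = here refl
∈-verticesUpTo (child v i) {suc n} (ℕ.s≤s v≤n) = there (∈-concatMap⁺ _
  (lose (∈-verticesUpTo v v≤n) (∈-map⁺ (child v) (∈-allFin i))))

level-verticesUpTo : ∀ n → All (λ v → level v ℕ.≤ n) (verticesUpTo n)
level-verticesUpTo zero    = ℕ.z≤n ∷ []
level-verticesUpTo (suc n) = ℕ.z≤n ∷ All.concat⁺ (All.map⁺ (All.map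
  (λ v≤n → All.map⁺ (All.tabulate (λ _ → ℕ.s≤s v≤n))) (level-verticesUpTo n)))

-- Local labelings that send the walk down

GoesDown : ∀ u → Port T u → LocalLabeling T u → Set
GoesDown u p π = ∃ λ j → Inverse.to π p ≡ (child u j , down u j)

record Descents (u : TVertex) (p : Port T u) (s : ℚ) : Set where
  field
    labelings  : List (LocalLabeling T u)
    inhabited  : NonZero (length labelings)
    distinct   : DistinctBijections labelings
    few        : length labelings ℕ.≤ degᵀ u !
    goesDown   : All (GoesDown u p) labelings
    s′         : ℚ
    s≤s′       : fromℕ (degᵀ u !) * s ≤ fromℕ (length labelings) * s′
    admissible : Admissible (2 ^ suc (level u)) s′

root-descends : (a : ∃ (TArc root)) → ∃ λ j → a ≡ (child root j , down root j)
root-descends (_ , down _ j) = j , refl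

-- The root has no arc up, so every labeling there descends and no mass is lost, although x = 1 is
-- too small for `admissible-rescale`. At any other vertex the arc up must avoid port `p`.
descents : ∀ u p {s} → 0ℚ ≤ s → Admissible (2 ^ level u) s → Descents u p s
descents root p {s} 0≤s s< = record
  { labelings  = localLabelings T root
  ; inhabited  = _
  ; distinct   = localLabelings-distinct T root
  ; few        = ℕ.≤-reflexive (length-localLabelings T root)
  ; goesDown   = All.tabulate λ {π} _ → root-descends (Inverse.to π p)
  ; s′         = s
  ; s≤s′       = ≤-refl
  -- From x = 1 to x = 2 without loss: (4 + 2) · 1 ≤ 2 · 1 · (4 + 1), that is 6 ≤ 10.
  ; admissible = admissible-double 1 {s} {s} 0≤s 1 1 refl (ℕ.m≤m+n 6 4) s<
  }
descents u@(child v i) p {s} 0≤s s< = record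
  { labelings  = map (degᵀ-counts u ↔-∘_) πs
  ; inhabited  = subst NonZero (sym len) (ℕ.m*n≢0 x (x !) {{x≢0}} {{x !≢0}})
  ; distinct   = relabel-distinct (degᵀ-counts u) (permutationsAvoidingZeroAt-distinct p)
  ; few        = subst (ℕ._≤ degᵀ u !) (sym len) (ℕ.*-monoˡ-≤ (x !) (ℕ.n≤1+n x))
  ; goesDown   = All.map⁺ (All.map (λ (j , eq) → j , cong (Inverse.to (degᵀ-counts u)) eq)
                   (permutationsAvoidingZeroAt-sound p))
  ; s′         = proj₁ rescaled
  ; s≤s′       = ≤-reflexive (trans (proj₁ (proj₂ rescaled)) (cong (λ n → fromℕ n * proj₁ rescaled) (sym len)))
  ; admissible = proj₂ (proj₂ rescaled)
  }
  where
  x  = 2 ^ level u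
  πs = permutationsAvoidingZeroAt p

  x≢0 : NonZero x
  x≢0 = ℕ.m^n≢0 2 (level u)

  len : length (map (degᵀ-counts u ↔-∘_) πs) ≡ x ℕ.* x !
  len = trans (length-map (degᵀ-counts u ↔-∘_) πs) (length-permutationsAvoidingZeroAt p)

  -- A child has level at least 1, hence x ≥ 2.
  rescaled = admissible-rescale x {{x≢0}} (ℕ.*-monoʳ-≤ 2 (ℕ.m^n>0 2 (level v))) 0≤s s<

All×Any⇒∃ : ∀ {A : Set} {P Q : A → Set} {xs} → All P xs → Any Q xs → ∃ λ x → P x × Q x
All×Any⇒∃ (p ∷ _)  (here q)   = _ , p , q
All×Any⇒∃ (_ ∷ ps) (there qs) = All×Any⇒∃ ps qs

-- Revealing the labeling level by level

module Descent (em : ExcludedMiddle 0ℓ) (C : CylinderSeq T) where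
  open Conditioning em T

  -- The walk has descended to u, which it is about to leave through p; ρ
  -- records the labels revealed so far.

  record Stage : Set where
    field
      u          : TVertex
      p          : Port T u
      ρ          : PartialLabeling
      s          : ℚ
      bound      : CondMass≤ C ρ s
      admissible : Admissible (2 ^ level u) s
      fresh      : ∀ w → level u ℕ.≤ level w → ρ w ≡ nothing

    state : State T
    state = u , p

  open Stage

  -- One round of revelation, listing all that the limit uses about the abstract `advance`. By
  -- `reveals` every vertex off the path is labeled eventually, too.
  record _⇝_ (S S′ : Stage) : Set where
    field
      extends : ρ S ⊑ ρ S′
      reveals : ∀ v → level v ℕ.≤ level (u S) → Defined (ρ S′) v
      label   : LocalLabeling T (u S)
      labeled : ρ S′ (u S) ≡ just label
      moves   : state S′ ≡ (let w = proj₁ (Inverse.to label (p S)) in w , nextPort T {u S} (p S) w)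
      deeper  : level (u S′) ≡ suc (level (u S))

  -- The path vertex receives its descending labeling `π` first; then `ρ′` fills in the other
  -- vertices up to its level.
  commit : (S : Stage) (π : LocalLabeling T (u S)) → GoesDown (u S) (p S) π →
    ∀ {s′} → Admissible (2 ^ suc (level (u S))) s′ →
    (∃ λ ρ′ → CondMass≤ C ρ′ s′ × update (ρ S) (u S) π ⊑ ρ′ ×
      All (Defined ρ′) (verticesUpTo (level (u S))) ×
      (∀ w → w ∉ verticesUpTo (level (u S)) → ρ′ w ≡ update (ρ S) (u S) π w)) →
    ∃ (S ⇝_)
  commit S π (j , to≡) {s′} adm (ρ′ , ρ′≤s′ , extends , defined , same) = S′ , record
    { extends = λ eq → extends (⊑-update (ρ S) (u S) π (fresh S (u S) ℕ.≤-refl) eq)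
    ; reveals = λ v v≤u → All.lookup defined (∈-verticesUpTo v v≤u)
    ; label   = π
    ; labeled = extends (update-same (ρ S) (u S) π)
    ; moves   = cong (λ a → proj₁ a , nextPort T {u S} (p S) (proj₁ a)) (sym to≡)
    ; deeper  = refl
    }
    where
    S′ : Stage
    S′ = record
      { u          = child (u S) j
      ; p          = nextPort T {u S} (p S) (child (u S) j)
      ; ρ          = ρ′
      ; s          = s′
      ; bound      = ρ′≤s′
      ; admissible = adm
      -- A vertex deeper than the old `u` is neither `u` nor in the list just filled in, so it is
      -- still unrevealed. This includes the new current vertex.
      ; fresh      = λ w u<w → trans
          (same w (λ w∈ → ℕ.<⇒≱ u<w (All.lookup (level-verticesUpTo (level (u S))) w∈)))
          (trans (update-other (ρ S) (u S) π (λ u≡w → ℕ.<-irrefl (cong level u≡w) u<w))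
                 (fresh S w (ℕ.<⇒≤ u<w)))
      }

  abstract
    advance : (S : Stage) → ∃ (S ⇝_)
    -- At index 0, `bound S` compares the empty sum with `s S` and so gives `0ℚ ≤ s S`.
    advance S = choose (descents (u S) (p S) (bound S 0) (admissible S))
      where
      choose : Descents (u S) (p S) (s S) → ∃ (S ⇝_)
      choose D =
        -- All candidates go down and some candidate satisfies the mass bound, so one does both.
        let π , goesDown , π≤s′ = All×Any⇒∃ D.goesDown (extend-at C (ρ S) (u S) (fresh S (u S) ℕ.≤-refl)
                                {{D.inhabited}} D.distinct D.few D.s≤s′ (bound S))
        in commit S π goesDown D.admissible (extend-all C (update (ρ S) (u S) π) π≤s′ (verticesUpTo (level (u S))))
        where module D = Descents D

  module Limit (S₀ : Stage) where

    stage : ℕ → Stage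
    stage zero    = S₀
    stage (suc n) = proj₁ (advance (stage n))

    module Step n = _⇝_ (proj₂ (advance (stage n)))

    level-stage : ∀ n → n ℕ.≤ level (u (stage n))
    level-stage zero    = ℕ.z≤n
    level-stage (suc n) = subst (suc n ℕ.≤_) (sym (Step.deeper n)) (ℕ.s≤s (level-stage n))

    ⊑-stage : ∀ {m n} → m ℕ.≤ n → ρ (stage m) ⊑ ρ (stage n)
    ⊑-stage m≤n = go (ℕ.≤⇒≤′ m≤n)
      where
      go : ∀ {m n} → m ℕ.≤′ n → ρ (stage m) ⊑ ρ (stage n)
      go ℕ.≤′-refl             eq = eq
      go (ℕ.≤′-step {n} m≤′n) eq = Step.extends n (go m≤′n eq)

    -- Stage `level v` is at level at least `level v`, so the round that follows it reveals `v`.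
    revealed : ∀ v → Defined (ρ (stage (suc (level v)))) v
    revealed v = Step.reveals (level v) v (level-stage (level v))

    ω : Labeling T
    ω v = proj₁ (revealed v)

    -- Stages extend one another, so both labels of `v` occur at the later of the two stages.
    ω-coherent : ∀ n {v π} → ρ (stage n) v ≡ just π → π ≡ ω v
    ω-coherent n {v} {π} eq with ℕ.≤-total n (suc (level v))
    ... | inj₁ n≤ = just-injective (trans (sym (⊑-stage n≤ eq)) (proj₂ (revealed v)))
    ... | inj₂ n≥ = just-injective (trans (sym eq) (⊑-stage n≥ (proj₂ (revealed v))))

    -- The label at the current vertex is fixed in the round that leaves it, and `ω` agrees with it
    -- by coherence.
    ω-walk : ∀ n → walk T ω (state S₀) n ≡ state (stage n)
    ω-walk zero    = refl
    ω-walk (suc n) = trans (cong (step T ω) (ω-walk n))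
      (trans (cong (λ π → let w = proj₁ (Inverse.to π (p (stage n))) in w , nextPort T {u (stage n)} (p (stage n)) w)
                   (sym (ω-coherent (suc n) (Step.labeled n))))
             (sym (Step.moves n)))

    ω-level : ∀ n → n ℕ.≤ level (position T ω (u S₀) (p S₀) n)
    ω-level n = subst (λ t → n ℕ.≤ level (proj₁ t)) (sym (ω-walk n)) (level-stage n)

    ω-escapes : EscapesToInfinity T (u S₀) (p S₀) ω
    ω-escapes = finitelyOften⇒unbounded T (u S₀) (p S₀) ω finite , finite
      where
      finite : ∀ v → ∃ λ N → ∀ n → N ℕ.≤ n → position T ω (u S₀) (p S₀) n ≢ v
      finite v = suc (level v) , λ n v<n eq →
        ℕ.<⇒≱ v<n (subst (λ w → n ℕ.≤ level w) eq (ω-level n))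

    ω-avoids : ∀ k → ¬ maybe′ (⟦_⟧ T) ∅ (C k) ω
    ω-avoids k ω∈ with C k in Ck
    ... | just c =
      -- A cylinder prescribes finitely many vertices, so some stage has revealed them all;
      -- `level v < n` unfolds to `suc (level v) ≤ n`, the stage index in `revealed`.
      let n , below = common-bound (λ (v , _) n → level v ℕ.< n) (λ _ m≤n v<m → ℕ.<-≤-trans v<m m≤n)
                        (All.tabulate {xs = Cylinder.prescribed c} λ {(v , _)} _ → suc (level v) , ℕ.≤-refl)
      in avoids C ω (ρ (stage n)) (bound (stage n)) (admissible⇒<1 (2 ^ level (u (stage n))) (admissible (stage n)))
           k Ck (All.map (λ {(v , _)} v<n → ⊑-stage v<n (proj₂ (revealed v))) below) ω∈

  uncovered : ∀ S₀ → ¬ Covers T C (EscapesToInfinity T (u S₀) (p S₀))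
  uncovered S₀ covers = let k , ω∈C = covers ω-escapes in ω-avoids k ω∈C
    where open Limit S₀

  initial : ∀ v₀ ℓ {q} → (∀ n → partialMass T C n ≤ q) → Admissible (2 ^ level v₀) q → Stage
  initial v₀ ℓ {q} total≤q adm = record
    { u          = v₀
    ; p          = ℓ
    ; ρ          = λ _ → nothing
    ; s          = q
    -- With nothing revealed, `condMass` computes to `mass`.
    ; bound      = total≤q
    ; admissible = adm
    ; fresh      = λ _ _ → refl
    }

-- Positive probability of escape

theorem4p8 : ExcludedMiddle 0ℓ → (v₀ : TVertex) (ℓ : Port T v₀) → HasPositiveProbability T (EscapesToInfinity T v₀ ℓ)
theorem4p8 em v₀ ℓ =
  measurable-escape verticesUpTo (λ v → level v , ∈-verticesUpTo v ℕ.≤-refl) v₀ ℓ ,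
  ε , 0<ε , λ q (C , covers , bound) → ≮⇒≥ λ q<ε →
    Descent.uncovered em C (Descent.initial em C v₀ ℓ bound
      (subst (fromℕ (4 ℕ.+ x) * q <_) scale
        (*-monoʳ-<-pos (fromℕ (4 ℕ.+ x)) {{normalize-pos (4 ℕ.+ x) 1}} q<ε)))
      covers
  where
  open Measurability em T

  x = 2 ^ level v₀
  -- This is x/(x+4), the lower bound for the product of the descent factors from level `level v₀`
  -- on. After multiplication by x + 4, `q < ε` becomes `Admissible x q`, so a cover of total mass
  -- `q` starts a descent.
  ε = + 1 / (4 ℕ.+ x) * fromℕ x

  scale : fromℕ (4 ℕ.+ x) * ε ≡ fromℕ x
  scale = trans (sym (*-assoc (fromℕ (4 ℕ.+ x)) (+ 1 / (4 ℕ.+ x)) (fromℕ x)))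
    (trans (cong (_* fromℕ x) (fromℕ-inverse (4 ℕ.+ x))) (*-identityˡ (fromℕ x)))

  0<ε : 0ℚ < ε
  0<ε = *-cancelˡ-<-nonNeg (fromℕ (4 ℕ.+ x)) {{nonNegative (0≤fromℕ (4 ℕ.+ x))}}
    (subst₂ _<_ (sym (*-zeroʳ (fromℕ (4 ℕ.+ x)))) (sym scale)
      (positive⁻¹ (fromℕ x) {{normalize-pos x 1 {{_}} {{ℕ.m^n≢0 2 (level v₀)}}}}))
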